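{- Let $M=\{(a,0),(0,a):a>0\}\cup\{(b,c):1\le b\le c\}$ (with $a,b,c$ integers), and let $P_M(t)=\sum_{n\ge0}p_{M,n}t^n$, where $p_{M,n}$ is the number of Catalan $M$-paths from $(0,0)$ to $(n,n)$. Then, as formal power series, $$P_M(t)=\frac{3t^2-t-1+\sqrt{1-14t+35t^2-30t^3+9t^4}}{4t(3t-2)}.$$
   Context: An $M$-path from $(0,0)$ to $(n,m)$ is a finite (possibly empty) sequence of steps in $M$ summing to $(n,m)$; its nodes are $(0,0)$ and the points reached after each step. The path is Catalan if every node $(x,y)$ satisfies $x<y+1$, i.e. $x\le y$. The square root is the power series square root with constant term $1$. -}

module Defs where

open import Data.Fin using (Fin; toℕ)
open import Data.Integer using (ℤ; +_; -_; 0ℤ; 1ℤ)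
import Data.Integer as ℤ
open import Data.Integer.Properties using (+-*-semiring)
open import Algebra.Properties.Semiring.Sum +-*-semiring using (sum)
open import Data.List using (List; []; _∷_; foldl)
open import Data.List.Relation.Unary.All using (All)
open import Data.List.Scans.Base using (scanl)
open import Data.Nat using (ℕ; zero; suc; _+_; _∸_; _<_; _≤_)
open import Data.Product using (Σ-syntax; _×_; _,_)
open import Function.Bundles using (_↔_)
open import Level using (0ℓ)
open import Relation.Binary.PropositionalEquality using (_≡_)
open import Relation.Nullary using (¬_)
open import Relation.Unary using (Pred)

Point : Set
Point = ℕ × ℕ

_+ᵖ_ : Point → Point → Point
(x , y) +ᵖ (a , b) = (x + a , y + b)

StepSet : Set₁
StepSet = Pred Point 0ℓ

-- The points required to be Catalan: (0,0) and every partial sum.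
nodes : List Point → List Point
nodes = scanl _+ᵖ_ (0 , 0)

endpoint : List Point → Point
endpoint = foldl _+ᵖ_ (0 , 0)

Catalan : Pred Point 0ℓ
Catalan (x , y) = x < y + 1

-- For a step set such as M below, whose membership proofs are unique, all the
-- components other than the list of steps are propositions, so two elements of
-- this type are equal exactly when their step sequences are.
CatalanPath : StepSet → Point → Set
CatalanPath S p =
  Σ[ steps ∈ List Point ]
    All S steps × endpoint steps ≡ p × All Catalan (nodes steps)

-- All coordinates of these steps are nonnegative, so nothing is lost by taking
-- points in ℕ × ℕ instead of ℤ × ℤ.  The three constructors are disjoint.
data M : StepSet where
  horizontal : ∀ {a} → 0 < a → M (a , 0)
  vertical   : ∀ {a} → 0 < a → M (0 , a)
  diagonal   : ∀ {b c} → 1 ≤ b → b ≤ c → M (b , c)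

CountsCatalanPaths : StepSet → (ℕ → ℕ) → Set
CountsCatalanPaths S p = ∀ n → CatalanPath S (n , n) ↔ Fin (p n)

-- ℤ[[t]], a series being its sequence of coefficients.
Series : Set
Series = ℕ → ℤ

infix  4 _≈_
infixl 6 _⊕_
infixl 7 _⊗_

_≈_ : Series → Series → Set
f ≈ g = ∀ n → f n ≡ g n

_⊕_ : Series → Series → Series
(f ⊕ g) n = f n ℤ.+ g n

_⊗_ : Series → Series → Series
(f ⊗ g) n = sum {suc n} (λ i → f (toℕ i) ℤ.* g (n ∸ toℕ i))

-- Coefficients are listed from the constant term upwards.
poly : List ℤ → Series
poly []       _       = 0ℤ
poly (c ∷ cs) zero    = c
poly (c ∷ cs) (suc n) = poly cs n

generatingFunction : (ℕ → ℕ) → Series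
generatingFunction p n = + p n

-- At most one series s satisfies this for a given f.
IsSqrt : Series → Series → Set
IsSqrt s f = s 0 ≡ 1ℤ × s ⊗ s ≈ f

-- q = f / g in the fraction field of the domain ℤ[[t]].  The denominator g may
-- have zero constant term; it only has to be nonzero, and q is then unique.
IsQuotient : Series → Series → Series → Set
IsQuotient q f g = ¬ (g ≈ poly []) × g ⊗ q ≈ f

-- 1 - 14t + 35t² - 30t³ + 9t⁴
radicand : Series
radicand = poly (+ 1 ∷ - (+ 14) ∷ + 35 ∷ - (+ 30) ∷ + 9 ∷ [])

-- 3t² - t - 1
numeratorPoly : Series
numeratorPoly = poly (- (+ 1) ∷ - (+ 1) ∷ + 3 ∷ [])

-- 4t(3t - 2)
denominator : Series
denominator = poly (0ℤ ∷ + 4 ∷ []) ⊗ poly (- (+ 2) ∷ + 3 ∷ [])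

{-# OPTIONS --safe #-}
module Submission where

-- Weight paths by the height y and let P_h be the series counting the paths to the
-- diagonal that start at height h above it, V_h and H_h those starting with a
-- vertical or horizontal step.  Building steps out of unit pieces makes all these
-- series satisfy local linear equations, which for h ≥ 1 are invariant under
-- shifting h and have a unique solution for a given H_1 = P_0.  Hence P_h is geometric for h ≥ 1,
-- which is used in the form P_0 (P_2 + V_2) = H_2 (P_1 + V_1); together with the
-- equations at h = 0 and h = 1 this gives a quadratic equation for q = P_0, and
-- the square root is recovered as 4t(3t - 2) q - (3t² - t - 1).

open import Defs
open import Algebra.Bundles using (CommutativeRing; RawRing)
import Algebra.Construct.Pointwise as Pointwise
import Algebra.Solver.Ring as RingSolver
open import Algebra.Solver.Ring.AlmostCommutativeRing
  using (fromCommutativeRing; _-Raw-AlmostCommutative⟶_; Induced-equivalence)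
open import Axiom.UniquenessOfIdentityProofs.WithK using (uip)
open import Data.Empty using (⊥)
open import Data.Fin using (Fin)
open import Data.Fin.Properties using (0↔⊥; 1↔⊤; +↔⊎)
open import Data.Integer using (ℤ; +_; -_; 0ℤ; 1ℤ)
import Data.Integer as ℤ
import Data.Integer.Properties as ℤ
import Data.Integer.Tactic.RingSolver as ℤ-Solver
open import Data.List using (List; []; _∷_; foldl; foldr)
open import Data.List.Properties using (∷-injectiveˡ; ∷-injectiveʳ)
open import Data.List.Relation.Unary.All using (All; []; _∷_)
import Data.List.Relation.Unary.All as All
open import Data.List.Scans.Base using (scanl)
open import Data.Maybe using (just; nothing)
open import Data.Nat using (ℕ; zero; suc; _+_; _≤_; _<_; z≤n; s≤s; z<s)
open import Data.Nat.Properties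
  using (suc-injective; +-suc; +-comm; +-assoc; +-identityʳ; +-cancelˡ-≡; +-cancelˡ-≤;
         ≤-refl; ≤-trans; ≤-pred; m≤m+n; m≤n⇒∃[o]m+o≡n; ≤-irrelevant; <-irrelevant)
import Data.Nat.Tactic.RingSolver as ℕ-Solver
open import Data.Product using (Σ-syntax; ∃-syntax; _×_; _,_; proj₁; proj₂; map₁)
open import Data.Product.Properties using (,-injectiveˡ; ,-injectiveʳ)
open import Data.Sum using (_⊎_; inj₁; inj₂)
open import Data.Sum.Function.Propositional using (_⊎-↔_)
open import Data.Unit using (⊤; tt)
open import Function using (_∘_; case_of_; Injective)
open import Function.Bundles using (_↔_; mk↔ₛ′)
open import Function.Construct.Composition using (_↔-∘_)
open import Function.Construct.Symmetry using (↔-sym)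
open import Level using (0ℓ)
open import Relation.Binary.PropositionalEquality
  using (_≡_; refl; sym; trans; cong; cong₂; subst; _→-setoid_)
open import Algebra.Consequences.Setoid (ℕ →-setoid ℤ) using (comm∧idˡ⇒id; comm∧distrʳ⇒distr)
open import Relation.Binary.Definitions using (WeaklyDecidable)
open import Relation.Nullary using (yes; no)

-- Enumeration of the paths

End : ℕ → ℕ → Set
End 0 0 = ⊤
End _ _ = ⊥

-- Here h = y - x is the height above the diagonal and s = n - y the height still
-- to be gained on a path to (n , n).  Hor, Ver and Dia are the paths whose first
-- step is of that kind; they peel a single unit off this step: what remains of a
-- diagonal step after removing (1 , 1) is nothing, a vertical or a diagonal step.
Path Hor Ver Dia : ℕ → ℕ → Set
Path h s = End h s ⊎ (Hor h s ⊎ (Ver h s ⊎ Dia h s))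

Hor zero    s = ⊥
Hor (suc h) s = Path h s ⊎ Hor h s

Ver h zero    = ⊥
Ver h (suc s) = Path (suc h) s ⊎ Ver (suc h) s

Dia h zero    = ⊥
Dia h (suc s) = Path h s ⊎ (Ver h s ⊎ Dia h s)

#End #Path #Hor #Ver #Dia : ℕ → ℕ → ℕ
#End 0 0 = 1
#End 0 (suc _) = 0
#End (suc _) _ = 0

#Path h s = #End h s + (#Hor h s + (#Ver h s + #Dia h s))

#Hor zero    s = 0
#Hor (suc h) s = #Path h s + #Hor h s

#Ver h zero    = 0
#Ver h (suc s) = #Path (suc h) s + #Ver (suc h) s

#Dia h zero    = 0
#Dia h (suc s) = #Path h s + (#Ver h s + #Dia h s)

infixr 1 _⊎-Fin_

_⊎-Fin_ : ∀ {A B : Set} {m n} → A ↔ Fin m → B ↔ Fin n → (A ⊎ B) ↔ Fin (m + n)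
f ⊎-Fin g = ↔-sym +↔⊎ ↔-∘ (f ⊎-↔ g)

⊥↔Fin0 : ⊥ ↔ Fin 0
⊥↔Fin0 = ↔-sym 0↔⊥

End↔ : ∀ h s → End h s ↔ Fin (#End h s)
End↔ zero    zero    = ↔-sym 1↔⊤
End↔ zero    (suc _) = ⊥↔Fin0
End↔ (suc _) _       = ⊥↔Fin0

Path↔ : ∀ h s → Path h s ↔ Fin (#Path h s)
Hor↔  : ∀ h s → Hor h s ↔ Fin (#Hor h s)
Ver↔  : ∀ h s → Ver h s ↔ Fin (#Ver h s)
Dia↔  : ∀ h s → Dia h s ↔ Fin (#Dia h s)
Path↔ h s = End↔ h s ⊎-Fin Hor↔ h s ⊎-Fin Ver↔ h s ⊎-Fin Dia↔ h s
Hor↔ zero    s = ⊥↔Fin0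
Hor↔ (suc h) s = Path↔ h s ⊎-Fin Hor↔ h s
Ver↔ h zero    = ⊥↔Fin0
Ver↔ h (suc s) = Path↔ (suc h) s ⊎-Fin Ver↔ (suc h) s
Dia↔ h zero    = ⊥↔Fin0
Dia↔ h (suc s) = Path↔ h s ⊎-Fin Ver↔ h s ⊎-Fin Dia↔ h s

-- Peeled paths as lists of steps

-- A first step (suc a , 0), (0 , suc a) or (suc b , suc b + d) is recorded as a,
-- a or (b , d).
decode    : ∀ h s → Path h s → List Point
decodeHor : ∀ h s → Hor h s → ℕ × List Point
decodeVer : ∀ h s → Ver h s → ℕ × List Point
decodeDia : ∀ h s → Dia h s → (ℕ × ℕ) × List Point

decode h s (inj₁ _) = []
decode h s (inj₂ (inj₁ p)) =
  let a , steps = decodeHor h s p in (suc a , 0) ∷ steps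
decode h s (inj₂ (inj₂ (inj₁ p))) =
  let a , steps = decodeVer h s p in (0 , suc a) ∷ steps
decode h s (inj₂ (inj₂ (inj₂ p))) =
  let (b , d) , steps = decodeDia h s p in (suc b , suc b + d) ∷ steps

decodeHor (suc h) s (inj₁ p) = 0 , decode h s p
decodeHor (suc h) s (inj₂ p) = map₁ suc (decodeHor h s p)

decodeVer h (suc s) (inj₁ p) = 0 , decode (suc h) s p
decodeVer h (suc s) (inj₂ p) = map₁ suc (decodeVer (suc h) s p)

decodeDia h (suc s) (inj₁ p)        = (0 , 0) , decode h s p
decodeDia h (suc s) (inj₂ (inj₁ p)) = map₁ (λ a → 0 , suc a) (decodeVer h s p)
decodeDia h (suc s) (inj₂ (inj₂ p)) = map₁ (map₁ suc) (decodeDia h s p)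

-- Bridge between `Path` and plain lists: steps are whole again, and the Catalan condition is built
-- in because the height index is a natural number.
data Walk : ℕ → ℕ → List Point → Set where
  stop : Walk 0 0 []
  hor  : ∀ {a h s steps} → Walk h s steps → Walk (suc a + h) s ((suc a , 0) ∷ steps)
  ver  : ∀ {a h s steps} → Walk (suc a + h) s steps → Walk h (suc a + s) ((0 , suc a) ∷ steps)
  dia  : ∀ {b d h s steps} → Walk (d + h) s steps →
         Walk h (suc b + d + s) ((suc b , suc b + d) ∷ steps)

walk    : ∀ h s p → Walk h s (decode h s p)
walkHor : ∀ h s p → let a , steps = decodeHor h s p in
          ∃[ h′ ] h ≡ suc a + h′ × Walk h′ s steps
walkVer : ∀ h s p → let a , steps = decodeVer h s p in
          ∃[ s′ ] s ≡ suc a + s′ × Walk (suc a + h) s′ steps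
walkDia : ∀ h s p → let (b , d) , steps = decodeDia h s p in
          ∃[ s′ ] s ≡ suc b + d + s′ × Walk (d + h) s′ steps

walk zero    zero    (inj₁ _) = stop
walk zero    (suc _) (inj₁ ())
walk (suc _) _       (inj₁ ())
walk h s (inj₂ (inj₁ p)) with _ , eq , w ← walkHor h s p =
  subst (λ k → Walk k s (decode h s (inj₂ (inj₁ p)))) (sym eq) (hor w)
walk h s (inj₂ (inj₂ (inj₁ p))) with _ , eq , w ← walkVer h s p =
  subst (λ k → Walk h k (decode h s (inj₂ (inj₂ (inj₁ p))))) (sym eq) (ver w)
walk h s (inj₂ (inj₂ (inj₂ p))) with _ , eq , w ← walkDia h s p =
  subst (λ k → Walk h k (decode h s (inj₂ (inj₂ (inj₂ p))))) (sym eq) (dia w)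

walkHor (suc h) s (inj₁ p) = h , refl , walk h s p
walkHor (suc h) s (inj₂ p) with h′ , eq , w ← walkHor h s p = h′ , cong suc eq , w

walkVer h (suc s) (inj₁ p) = s , refl , walk (suc h) s p
walkVer h (suc s) (inj₂ p) with s′ , eq , w ← walkVer (suc h) s p =
  s′ , cong suc eq , subst (λ k → Walk k s′ (proj₂ (decodeVer (suc h) s p))) (+-suc _ h) w

walkDia h (suc s) (inj₁ p)        = s , refl , walk h s p
walkDia h (suc s) (inj₂ (inj₁ p)) with s′ , eq , w ← walkVer h s p = s′ , cong suc eq , w
walkDia h (suc s) (inj₂ (inj₂ p)) with s′ , eq , w ← walkDia h s p = s′ , cong suc eq , w

encodeHor : ∀ a {h s} (p : Path h s) →
        Σ[ q ∈ Hor (suc a + h) s ] decodeHor (suc a + h) s q ≡ (a , decode h s p)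
encodeHor zero    p = inj₁ p , refl
encodeHor (suc a) p with q , eq ← encodeHor a p = inj₂ q , cong (map₁ suc) eq

-- The height `k` is kept apart from `suc a + h` because the recursion passes from `h` to `suc h`;
-- this way only the equation is adjusted and `p` is never transported.
encodeVer : ∀ a {h k s} → k ≡ suc a + h → (p : Path k s) →
        Σ[ q ∈ Ver h (suc a + s) ] decodeVer h (suc a + s) q ≡ (a , decode k s p)
encodeVer zero    refl p = inj₁ p , refl
encodeVer (suc a) {h} eq p with q , eq′ ← encodeVer a (trans eq (sym (cong suc (+-suc a h)))) p =
  inj₂ q , cong (map₁ suc) eq′

encodeDia : ∀ b d {h s} (p : Path (d + h) s) →
        Σ[ q ∈ Dia h (suc b + d + s) ]
          decodeDia h (suc b + d + s) q ≡ ((b , d) , decode (d + h) s p)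
encodeDia zero    zero    p = inj₁ p , refl
-- Removing (1 , 1) from the step (1 , 2 + d) leaves the vertical step (0 , 1 + d).
encodeDia zero    (suc d) p with q , eq ← encodeVer d refl p =
  inj₂ (inj₁ q) , cong (map₁ (λ a → 0 , suc a)) eq
encodeDia (suc b) d       p with q , eq ← encodeDia b d p =
  inj₂ (inj₂ q) , cong (map₁ (map₁ suc)) eq

encode : ∀ {h s steps} → Walk h s steps → Σ[ p ∈ Path h s ] decode h s p ≡ steps
encode stop = inj₁ tt , refl
encode (hor {a} w) with p , refl ← encode w with q , eq ← encodeHor a p =
  inj₂ (inj₁ q) , cong (λ (a , steps) → (suc a , 0) ∷ steps) eq
encode (ver {a} w) with p , refl ← encode w with q , eq ← encodeVer a refl p =
  inj₂ (inj₂ (inj₁ q)) , cong (λ (a , steps) → (0 , suc a) ∷ steps) eq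
encode (dia {b} {d} w) with p , refl ← encode w with q , eq ← encodeDia b d p =
  inj₂ (inj₂ (inj₂ q)) , cong (λ ((b , d) , steps) → (suc b , suc b + d) ∷ steps) eq

-- The first step determines the summand: the three kinds have disjoint shapes, and for a diagonal
-- step `b` and `d` tell what was left after removing a unit.
decode-injective    : ∀ h s → Injective _≡_ _≡_ (decode h s)
decodeHor-injective : ∀ h s → Injective _≡_ _≡_ (decodeHor h s)
decodeVer-injective : ∀ h s → Injective _≡_ _≡_ (decodeVer h s)
decodeDia-injective : ∀ h s → Injective _≡_ _≡_ (decodeDia h s)

decode-injective zero zero {inj₁ _} {inj₁ _} _ = refl
decode-injective h s {inj₁ _} {inj₂ (inj₁ _)} ()
decode-injective h s {inj₁ _} {inj₂ (inj₂ (inj₁ _))} ()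
decode-injective h s {inj₁ _} {inj₂ (inj₂ (inj₂ _))} ()
decode-injective h s {inj₂ (inj₁ _)} {inj₂ (inj₂ (inj₁ _))} ()
decode-injective h s {inj₂ (inj₁ _)} {inj₂ (inj₂ (inj₂ _))} ()
decode-injective h s {inj₂ (inj₁ p)} {inj₂ (inj₁ q)} eq =
  cong (inj₂ ∘ inj₁) (decodeHor-injective h s
    (cong₂ _,_ (suc-injective (,-injectiveˡ (∷-injectiveˡ eq))) (∷-injectiveʳ eq)))
decode-injective h s {inj₂ (inj₂ (inj₁ p))} {inj₂ (inj₂ (inj₁ q))} eq =
  cong (inj₂ ∘ inj₂ ∘ inj₁) (decodeVer-injective h s
    (cong₂ _,_ (suc-injective (,-injectiveʳ (∷-injectiveˡ eq))) (∷-injectiveʳ eq)))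
decode-injective h s {inj₂ (inj₂ (inj₂ p))} {inj₂ (inj₂ (inj₂ q))} eq =
  cong (inj₂ ∘ inj₂ ∘ inj₂) (decodeDia-injective h s
    (cong₂ _,_ (step-injective (∷-injectiveˡ eq)) (∷-injectiveʳ eq)))
  where
  step-injective : ∀ {b d b′ d′} → (suc b , suc b + d) ≡ (suc b′ , suc b′ + d′) → (b , d) ≡ (b′ , d′)
  step-injective {b} eq with refl ← ,-injectiveˡ eq =
    cong (b ,_) (+-cancelˡ-≡ (suc b) _ _ (,-injectiveʳ eq))

decodeHor-injective (suc h) s {inj₁ p} {inj₁ q} eq =
  cong inj₁ (decode-injective h s (,-injectiveʳ eq))
decodeHor-injective (suc h) s {inj₂ p} {inj₂ q} eq =
  cong inj₂ (decodeHor-injective h s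
    (cong₂ _,_ (suc-injective (,-injectiveˡ eq)) (,-injectiveʳ eq)))

decodeVer-injective h (suc s) {inj₁ p} {inj₁ q} eq =
  cong inj₁ (decode-injective (suc h) s (,-injectiveʳ eq))
decodeVer-injective h (suc s) {inj₂ p} {inj₂ q} eq =
  cong inj₂ (decodeVer-injective (suc h) s
    (cong₂ _,_ (suc-injective (,-injectiveˡ eq)) (,-injectiveʳ eq)))

decodeDia-injective h (suc s) {inj₁ p} {inj₁ q} eq =
  cong inj₁ (decode-injective h s (,-injectiveʳ eq))
decodeDia-injective h (suc s) {inj₁ _} {inj₂ (inj₁ _)} ()
decodeDia-injective h (suc s) {inj₁ _} {inj₂ (inj₂ _)} ()
decodeDia-injective h (suc s) {inj₂ (inj₁ p)} {inj₂ (inj₁ q)} eq =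
  cong (inj₂ ∘ inj₁) (decodeVer-injective h s
    (cong₂ _,_ (suc-injective (,-injectiveʳ (,-injectiveˡ eq))) (,-injectiveʳ eq)))
decodeDia-injective h (suc s) {inj₂ (inj₂ p)} {inj₂ (inj₂ q)} eq =
  cong (inj₂ ∘ inj₂) (decodeDia-injective h s
    (cong₂ _,_ (cong₂ _,_ (suc-injective (,-injectiveˡ (,-injectiveˡ eq)))
                          (,-injectiveʳ (,-injectiveˡ eq)))
               (,-injectiveʳ eq)))

-- Bijection between Catalan paths and peeled paths

-- The start is arbitrary so that induction on the steps goes through; from (0 , 0) these are
-- exactly the conditions in `CatalanPath`.
Valid : Point → Point → List Point → Set
Valid q p steps = All M steps × foldl _+ᵖ_ q steps ≡ p × All Catalan (scanl _+ᵖ_ q steps)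

-- Used after the first step: its rise is then at most `s`, so `s` can be split in `valid⇒walk`.
height≤endpoint : ∀ {x y n m} steps → foldl _+ᵖ_ (x , y) steps ≡ (n , m) → y ≤ m
height≤endpoint []                refl = ≤-refl
height≤endpoint ((_ , b) ∷ steps) eq   = ≤-trans (m≤m+n _ b) (height≤endpoint steps eq)

headCatalan : ∀ {q} steps → All Catalan (scanl _+ᵖ_ q steps) → Catalan q
headCatalan []      (c ∷ _) = c
headCatalan (_ ∷ _) (c ∷ _) = c

≤⇒catalan : ∀ {x y} → x ≤ y → Catalan (x , y)
≤⇒catalan {x} {y} x≤y = subst (x <_) (+-comm 1 y) (s≤s x≤y)

catalan⇒≤ : ∀ {x y} → Catalan (x , y) → x ≤ y
catalan⇒≤ {x} {y} x<y+1 = ≤-pred (subst (x <_) (+-comm y 1) x<y+1)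

hor-x : ∀ x a h → (x + a) + h ≡ (x + (a + h)) + 0
hor-x = ℕ-Solver.solve-∀

ver-x : ∀ x a h → (x + 0) + (a + h) ≡ (x + h) + a
ver-x = ℕ-Solver.solve-∀

dia-x : ∀ x b d h → (x + b) + (d + h) ≡ (x + h) + (b + d)
dia-x = ℕ-Solver.solve-∀

valid⇒walk : ∀ {h s x y n} steps → x + h ≡ y → y + s ≡ n →
             Valid (x , y) (n , n) steps → Walk h s steps
valid⇒walk {h} {s} {x} [] hx sy (_ , refl , _)
  with refl ← +-cancelˡ-≡ x h 0 (trans hx (sym (+-identityʳ x)))
     | refl ← +-cancelˡ-≡ x s 0 (trans sy (sym (+-identityʳ x)))
  = stop
valid⇒walk {h} {s} {x} (_ ∷ steps) refl refl (horizontal {suc a} _ ∷ ms , end , _ ∷ cs)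
  -- The Catalan condition at the node after the step bounds its length by `h`.
  with h′ , refl ← m≤n⇒∃[o]m+o≡n
         (+-cancelˡ-≤ x (suc a) h
           (subst (x + suc a ≤_) (+-identityʳ (x + h)) (catalan⇒≤ (headCatalan steps cs))))
  = hor (valid⇒walk steps (hor-x x (suc a) h′) (cong (_+ s) (+-identityʳ (x + (suc a + h′)))) (ms , end , cs))
valid⇒walk {h} {s} {x} (_ ∷ steps) refl refl (vertical {suc a} _ ∷ ms , end , _ ∷ cs)
  with s′ , refl ← m≤n⇒∃[o]m+o≡n (+-cancelˡ-≤ (x + h) (suc a) s (height≤endpoint steps end))
  = ver (valid⇒walk steps (ver-x x (suc a) h) (+-assoc (x + h) (suc a) s′) (ms , end , cs))
valid⇒walk {h} {s} {x} (_ ∷ steps) refl refl (diagonal {suc b} {c} _ b≤c ∷ ms , end , _ ∷ cs)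
  with d , refl ← m≤n⇒∃[o]m+o≡n b≤c
  with s′ , refl ← m≤n⇒∃[o]m+o≡n (+-cancelˡ-≤ (x + h) (suc b + d) s (height≤endpoint steps end))
  = dia (valid⇒walk steps (dia-x x (suc b) d h) (+-assoc (x + h) (suc b + d) s′) (ms , end , cs))

walk⇒valid : ∀ {h s x y n steps} → x + h ≡ y → y + s ≡ n →
             Walk h s steps → Valid (x , y) (n , n) steps
walk⇒valid {x = x} refl refl stop =
  [] , cong₂ _,_ (sym (trans (+-identityʳ (x + 0)) (+-identityʳ x))) (sym (+-identityʳ (x + 0))) ,
  ≤⇒catalan (m≤m+n x 0) ∷ []
walk⇒valid {h} {s} {x} refl refl (hor {a} {h′} w)
  with ms , end , cs ← walk⇒valid (hor-x x (suc a) h′) (cong (_+ s) (+-identityʳ (x + h))) w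
  = horizontal z<s ∷ ms , end , ≤⇒catalan (m≤m+n x h) ∷ cs
walk⇒valid {h} {x = x} refl refl (ver {a} {s = s′} w)
  with ms , end , cs ← walk⇒valid (ver-x x (suc a) h) (+-assoc (x + h) (suc a) s′) w
  = vertical z<s ∷ ms , end , ≤⇒catalan (m≤m+n x h) ∷ cs
walk⇒valid {h} {x = x} refl refl (dia {b} {d} {s = s′} w)
  with ms , end , cs ← walk⇒valid (dia-x x (suc b) d h) (+-assoc (x + h) (suc b + d) s′) w
  = diagonal z<s (m≤m+n (suc b) d) ∷ ms , end , ≤⇒catalan (m≤m+n x h) ∷ cs

M-irrelevant : ∀ {p} (m m′ : M p) → m ≡ m′
M-irrelevant (horizontal a) (horizontal a′) = cong horizontal (<-irrelevant a a′)
M-irrelevant (horizontal ()) (vertical _)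
M-irrelevant (horizontal _) (diagonal () z≤n)
M-irrelevant (vertical ()) (horizontal _)
M-irrelevant (vertical a) (vertical a′) = cong vertical (<-irrelevant a a′)
M-irrelevant (vertical _) (diagonal () _)
M-irrelevant (diagonal () z≤n) (horizontal _)
M-irrelevant (diagonal () _) (vertical _)
M-irrelevant (diagonal b c) (diagonal b′ c′) = cong₂ diagonal (≤-irrelevant b b′) (≤-irrelevant c c′)

valid-irrelevant : ∀ {q p steps} (v v′ : Valid q p steps) → v ≡ v′
valid-irrelevant (ms , e , cs) (ms′ , e′ , cs′) =
  cong₂ _,_ (All.irrelevant M-irrelevant ms ms′)
    (cong₂ _,_ (uip e e′) (All.irrelevant <-irrelevant cs cs′))

catalanPath≡ : ∀ {p} {v v′ : CatalanPath M p} → proj₁ v ≡ proj₁ v′ → v ≡ v′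
catalanPath≡ refl = cong (_ ,_) (valid-irrelevant _ _)

CatalanPath↔Path : ∀ n → CatalanPath M (n , n) ↔ Path 0 n
CatalanPath↔Path n = mk↔ₛ′ to from
  -- Both inverse laws rest on `decode-to`; here the two paths have the same steps, so they agree by
  -- injectivity.
  (λ p → decode-injective 0 n (decode-to (from p)))
  (λ v → catalanPath≡ (decode-to v))
  where
  encoded : ((steps , _) : CatalanPath M (n , n)) → Σ[ p ∈ Path 0 n ] decode 0 n p ≡ steps
  encoded (steps , v) = encode (valid⇒walk steps refl refl v)

  to : CatalanPath M (n , n) → Path 0 n
  to v = proj₁ (encoded v)

  from : Path 0 n → CatalanPath M (n , n)
  from p = decode 0 n p , walk⇒valid refl refl (walk 0 n p)

  decode-to : ∀ v → decode 0 n (to v) ≡ proj₁ v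
  decode-to v = proj₂ (encoded v)

counts : CountsCatalanPaths M (#Path 0)
counts n = Path↔ 0 n ↔-∘ CatalanPath↔Path n

-- The ring of power series

tail : Series → Series
tail f n = f (suc n)

constant : ℤ → Series
constant c = poly (c ∷ [])

t : Series
t = poly (0ℤ ∷ 1ℤ ∷ [])

⊖_ : Series → Series
(⊖ f) n = - f n

-- The coefficient of (f ⊗ g) (suc n) unfolds to f 0 ℤ.* g (suc n) ℤ.+ (tail f ⊗ g) n.
⊗-cong : ∀ {f f′ g g′} → f ≈ f′ → g ≈ g′ → f ⊗ g ≈ f′ ⊗ g′
⊗-cong f≈ g≈ zero    = cong₂ (λ x y → x ℤ.* y ℤ.+ 0ℤ) (f≈ 0) (g≈ 0)
⊗-cong f≈ g≈ (suc n) =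
  cong₂ ℤ._+_ (cong₂ ℤ._*_ (f≈ 0) (g≈ (suc n))) (⊗-cong (λ m → f≈ (suc m)) g≈ n)

⊗-distribʳ : ∀ h f g → (f ⊕ g) ⊗ h ≈ (f ⊗ h) ⊕ (g ⊗ h)
⊗-distribʳ h f g zero    = lemma (f 0) (g 0) (h 0)
  where
  lemma : ∀ a b c → (a ℤ.+ b) ℤ.* c ℤ.+ 0ℤ ≡ (a ℤ.* c ℤ.+ 0ℤ) ℤ.+ (b ℤ.* c ℤ.+ 0ℤ)
  lemma = ℤ-Solver.solve-∀
⊗-distribʳ h f g (suc n) =
  trans (cong (ℤ._+_ ((f 0 ℤ.+ g 0) ℤ.* h (suc n))) (⊗-distribʳ h (tail f) (tail g) n))
        (lemma (f 0) (g 0) (h (suc n)) ((tail f ⊗ h) n) ((tail g ⊗ h) n))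
  where
  lemma : ∀ a b c x y →
          (a ℤ.+ b) ℤ.* c ℤ.+ (x ℤ.+ y) ≡ (a ℤ.* c ℤ.+ x) ℤ.+ (b ℤ.* c ℤ.+ y)
  lemma = ℤ-Solver.solve-∀

scale-⊗ : ∀ c f g n → ((λ m → c ℤ.* f m) ⊗ g) n ≡ c ℤ.* (f ⊗ g) n
scale-⊗ c f g zero    = lemma c (f 0) (g 0)
  where
  lemma : ∀ a b c → a ℤ.* b ℤ.* c ℤ.+ 0ℤ ≡ a ℤ.* (b ℤ.* c ℤ.+ 0ℤ)
  lemma = ℤ-Solver.solve-∀
scale-⊗ c f g (suc n) =
  trans (cong (ℤ._+_ (c ℤ.* f 0 ℤ.* g (suc n))) (scale-⊗ c (tail f) g n))
        (lemma c (f 0) (g (suc n)) ((tail f ⊗ g) n))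
  where
  lemma : ∀ a b c x → a ℤ.* b ℤ.* c ℤ.+ a ℤ.* x ≡ a ℤ.* (b ℤ.* c ℤ.+ x)
  lemma = ℤ-Solver.solve-∀

-- The product unfolds at the summand containing `f 0`; splitting off the opposite end, with `g 0`,
-- is what the induction for `⊗-comm` needs.
⊗-sucʳ : ∀ f g n → (f ⊗ g) (suc n) ≡ (f ⊗ tail g) n ℤ.+ f (suc n) ℤ.* g 0
⊗-sucʳ f g zero    = lemma (f 0) (g 1) (f 1) (g 0)
  where
  lemma : ∀ a b c d → a ℤ.* b ℤ.+ (c ℤ.* d ℤ.+ 0ℤ) ≡ a ℤ.* b ℤ.+ 0ℤ ℤ.+ c ℤ.* d
  lemma = ℤ-Solver.solve-∀
⊗-sucʳ f g (suc n) =
  trans (cong (ℤ._+_ (f 0 ℤ.* g (suc (suc n)))) (⊗-sucʳ (tail f) g n))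
        (sym (ℤ.+-assoc (f 0 ℤ.* g (suc (suc n))) ((tail f ⊗ tail g) n) _))

⊗-comm : ∀ f g → f ⊗ g ≈ g ⊗ f
⊗-comm f g zero    = cong (ℤ._+ 0ℤ) (ℤ.*-comm (f 0) (g 0))
⊗-comm f g (suc n) =
  trans (cong₂ ℤ._+_ (ℤ.*-comm (f 0) (g (suc n))) (⊗-comm (tail f) g n))
  (trans (ℤ.+-comm (g (suc n) ℤ.* f 0) _)
         (sym (⊗-sucʳ g f n)))

⊗-assoc : ∀ f g h → (f ⊗ g) ⊗ h ≈ f ⊗ (g ⊗ h)
⊗-assoc f g h zero    = lemma (f 0) (g 0) (h 0)
  where
  lemma : ∀ a b c → (a ℤ.* b ℤ.+ 0ℤ) ℤ.* c ℤ.+ 0ℤ ≡ a ℤ.* (b ℤ.* c ℤ.+ 0ℤ) ℤ.+ 0ℤ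
  lemma = ℤ-Solver.solve-∀
⊗-assoc f g h (suc n) =
  trans (cong (ℤ._+_ ((f ⊗ g) 0 ℤ.* h (suc n)))
          (trans (⊗-distribʳ h (λ m → f 0 ℤ.* tail g m) (tail f ⊗ g) n)
                 (cong₂ ℤ._+_ (scale-⊗ (f 0) (tail g) h n) (⊗-assoc (tail f) g h n))))
        (lemma (f 0) (g 0) (h (suc n)) ((tail g ⊗ h) n) ((tail f ⊗ (g ⊗ h)) n))
  where
  lemma : ∀ a b c x y → (a ℤ.* b ℤ.+ 0ℤ) ℤ.* c ℤ.+ (a ℤ.* x ℤ.+ y) ≡ a ℤ.* (b ℤ.* c ℤ.+ x) ℤ.+ y
  lemma = ℤ-Solver.solve-∀

⊗-zeroˡ : ∀ f → poly [] ⊗ f ≈ poly []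
⊗-zeroˡ f zero    = refl
⊗-zeroˡ f (suc n) = trans (cong (ℤ._+_ (0ℤ ℤ.* f (suc n))) (⊗-zeroˡ f n)) refl

constant-⊗ : ∀ c f n → (constant c ⊗ f) n ≡ c ℤ.* f n
constant-⊗ c f zero    = ℤ.+-identityʳ _
constant-⊗ c f (suc n) =
  trans (cong (ℤ._+_ (c ℤ.* f (suc n))) (⊗-zeroˡ f n)) (ℤ.+-identityʳ (c ℤ.* f (suc n)))

⊗-identityˡ : ∀ f → constant 1ℤ ⊗ f ≈ f
⊗-identityˡ f n = trans (constant-⊗ 1ℤ f n) (ℤ.*-identityˡ _)

t⊗-suc : ∀ f n → (t ⊗ f) (suc n) ≡ f n
t⊗-suc f n = trans (ℤ.+-identityˡ ((constant 1ℤ ⊗ f) n)) (⊗-identityˡ f n)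

seriesRing : CommutativeRing 0ℓ 0ℓ
seriesRing = record
  { Carrier = Series ; _≈_ = _≈_ ; _+_ = _⊕_ ; _*_ = _⊗_ ; -_ = ⊖_
  ; 0# = poly [] ; 1# = constant 1ℤ
  ; isCommutativeRing = record
    { isRing = record
      { +-isAbelianGroup = Pointwise.isAbelianGroup ℕ ℤ.+-0-isAbelianGroup
      ; *-cong     = ⊗-cong
      ; *-assoc    = ⊗-assoc
      ; *-identity = comm∧idˡ⇒id ⊗-comm ⊗-identityˡ
      ; distrib    = comm∧distrʳ⇒distr (λ f≈ g≈ n → cong₂ ℤ._+_ (f≈ n) (g≈ n)) ⊗-comm ⊗-distribʳ
      }
    ; *-comm = ⊗-comm
    }
  }

ℤ-rawRing : RawRing 0ℓ 0ℓ
ℤ-rawRing = CommutativeRing.rawRing ℤ.+-*-commutativeRing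

-- The solver has to compare coefficients; this is possible for integers embedded as constants,
-- whereas equality of series is not decidable.
constant-morphism : ℤ-rawRing -Raw-AlmostCommutative⟶ fromCommutativeRing seriesRing
constant-morphism = record
  { ⟦_⟧    = constant
  ; +-homo = λ { a b zero → refl ; a b (suc n) → refl }
  ; *-homo = λ { a b zero    → sym (constant-⊗ a (constant b) zero)
               ; a b (suc n) → sym (trans (constant-⊗ a (constant b) (suc n)) (ℤ.*-zeroʳ a)) }
  ; -‿homo = λ { a zero → refl ; a (suc n) → refl }
  ; 0-homo = λ { zero → refl ; (suc n) → refl }
  ; 1-homo = λ _ → refl
  }

constant≟ : WeaklyDecidable (Induced-equivalence constant-morphism)
constant≟ a b = case a ℤ.≟ b of λ { (yes refl) → just (λ _ → refl) ; (no _) → nothing }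

open RingSolver ℤ-rawRing (fromCommutativeRing seriesRing) constant-morphism constant≟
  using (Polynomial; solve; _:=_; _:+_; _:*_; _:-_; con)

open CommutativeRing seriesRing using (+-cong; -‿cong; +-congˡ; +-congʳ; *-congˡ; *-congʳ)
  renaming (refl to ≈-refl; sym to ≈-sym; trans to ≈-trans; +-identityʳ to ⊕-identityʳ)

-- The linear system and uniqueness of its solution

-- The local equations for heights h ≥ 1, re-indexed from 0; shift and scale are
-- the two symmetries of the system.
record Solution (b : Series) : Set where
  field
    P H V D : ℕ → Series
    H-zero : H 0 ≈ b
    H-suc  : ∀ h → H (suc h) ≈ P h ⊕ H h
    V-step : ∀ h → V h ≈ t ⊗ (P (suc h) ⊕ V (suc h))
    D-step : ∀ h → D h ≈ t ⊗ (P h ⊕ (V h ⊕ D h))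
    P-step : ∀ h → P h ≈ H h ⊕ (V h ⊕ D h)

open Solution

shift : ∀ {b} (S : Solution b) → Solution (H S 1)
shift S = record
  { P = λ h → P S (suc h) ; H = λ h → H S (suc h)
  ; V = λ h → V S (suc h) ; D = λ h → D S (suc h)
  ; H-zero = ≈-refl
  ; H-suc  = λ h → H-suc S (suc h)
  ; V-step = λ h → V-step S (suc h)
  ; D-step = λ h → D-step S (suc h)
  ; P-step = λ h → P-step S (suc h)
  }

scale : ∀ c {b} → Solution b → Solution (c ⊗ b)
scale c S = record
  { P = λ h → c ⊗ P S h ; H = λ h → c ⊗ H S h
  ; V = λ h → c ⊗ V S h ; D = λ h → c ⊗ D S h
  ; H-zero = *-congˡ {c} (H-zero S)
  ; H-suc  = λ h → ≈-trans (*-congˡ {c} (H-suc S h))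
      (solve 3 (λ c x y → c :* (x :+ y) := c :* x :+ c :* y) (λ _ → refl) c (P S h) (H S h))
  ; V-step = λ h → ≈-trans (*-congˡ {c} (V-step S h))
      (solve 4 (λ c t x y → c :* (t :* (x :+ y)) := t :* (c :* x :+ c :* y)) (λ _ → refl)
        c t (P S (suc h)) (V S (suc h)))
  ; D-step = λ h → ≈-trans (*-congˡ {c} (D-step S h))
      (solve 5 (λ c t x y z → c :* (t :* (x :+ (y :+ z))) := t :* (c :* x :+ (c :* y :+ c :* z))) (λ _ → refl)
        c t (P S h) (V S h) (D S h))
  ; P-step = λ h → ≈-trans (*-congˡ {c} (P-step S h))
      (solve 4 (λ c x y z → c :* (x :+ (y :+ z)) := c :* x :+ (c :* y :+ c :* z)) (λ _ → refl)
        c (H S h) (V S h) (D S h))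
  }

module _ {b b′} (b≈b′ : b ≈ b′) (S : Solution b) (S′ : Solution b′) where

  -- Induction on the coefficient `n`, then on `h`: `H-suc` lowers `h` at fixed `n`, and the factor
  -- `t` in `V-step` and `D-step` lowers `n`, which pays for the rise of `h` in `V-step`.
  P-unique : ∀ h → P S h ≈ P S′ h
  H-unique : ∀ h → H S h ≈ H S′ h
  V-unique : ∀ h → V S h ≈ V S′ h
  D-unique : ∀ h → D S h ≈ D S′ h

  P-unique h n = trans (P-step S h n) (trans
    (cong₂ ℤ._+_ (H-unique h n) (cong₂ ℤ._+_ (V-unique h n) (D-unique h n)))
    (sym (P-step S′ h n)))

  H-unique zero    n = trans (H-zero S n) (trans (b≈b′ n) (sym (H-zero S′ n)))
  H-unique (suc h) n = trans (H-suc S h n) (trans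
    (cong₂ ℤ._+_ (P-unique h n) (H-unique h n))
    (sym (H-suc S′ h n)))

  V-unique h zero    = trans (V-step S h 0) (sym (V-step S′ h 0))
  V-unique h (suc n) = trans (V-step S h (suc n)) (trans (t⊗-suc (P S (suc h) ⊕ V S (suc h)) n) (trans
    (cong₂ ℤ._+_ (P-unique (suc h) n) (V-unique (suc h) n))
    (sym (trans (V-step S′ h (suc n)) (t⊗-suc (P S′ (suc h) ⊕ V S′ (suc h)) n)))))

  D-unique h zero    = trans (D-step S h 0) (sym (D-step S′ h 0))
  D-unique h (suc n) = trans (D-step S h (suc n)) (trans (t⊗-suc (P S h ⊕ (V S h ⊕ D S h)) n) (trans
    (cong₂ ℤ._+_ (P-unique h n) (cong₂ ℤ._+_ (V-unique h n) (D-unique h n)))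
    (sym (trans (D-step S′ h (suc n)) (t⊗-suc (P S′ h ⊕ (V S′ h ⊕ D S′ h)) n)))))

-- Generating functions of the peeled paths

Path₊ Hor₊ Ver₊ Dia₊ : ℕ → Series
Path₊ h n = + #Path h n
Hor₊  h n = + #Hor h n
Ver₊  h n = + #Ver h n
Dia₊  h n = + #Dia h n

Ver₊-step : ∀ h → Ver₊ h ≈ t ⊗ (Path₊ (suc h) ⊕ Ver₊ (suc h))
Ver₊-step h zero    = refl
Ver₊-step h (suc n) = sym (t⊗-suc (Path₊ (suc h) ⊕ Ver₊ (suc h)) n)

Dia₊-step : ∀ h → Dia₊ h ≈ t ⊗ (Path₊ h ⊕ (Ver₊ h ⊕ Dia₊ h))
Dia₊-step h zero    = refl
Dia₊-step h (suc n) = sym (t⊗-suc (Path₊ h ⊕ (Ver₊ h ⊕ Dia₊ h)) n)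

q : Series
q = Path₊ 0

q-step : q ≈ constant 1ℤ ⊕ (Ver₊ 0 ⊕ Dia₊ 0)
q-step zero    = refl
q-step (suc n) = sym (ℤ.+-identityˡ _)

-- The empty path exists only at height 0, so the equations are homogeneous from height 1 on. The
-- boundary value is `q` because `#Hor 0` vanishes.
pathsAboveDiagonal : Solution q
pathsAboveDiagonal = record
  { P = λ h → Path₊ (suc h) ; H = λ h → Hor₊ (suc h)
  ; V = λ h → Ver₊ (suc h) ; D = λ h → Dia₊ (suc h)
  ; H-zero = λ n → cong +_ (+-identityʳ (#Path 0 n))
  ; H-suc  = λ _ _ → refl
  ; V-step = λ h → Ver₊-step (suc h)
  ; D-step = λ h → Dia₊-step (suc h)
  ; P-step = λ _ _ → refl
  }

-- Shifting and scaling by q, or only scaling by Hor₊ 2, leads to the same boundary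
-- value q ⊗ Hor₊ 2, hence to the same solution.
cross-ratio : q ⊗ (Path₊ 2 ⊕ Ver₊ 2) ≈ Hor₊ 2 ⊗ (Path₊ 1 ⊕ Ver₊ 1)
cross-ratio =
  ≈-trans (solve 3 (λ q x y → q :* (x :+ y) := q :* x :+ q :* y) (λ _ → refl) q (Path₊ 2) (Ver₊ 2))
  (≈-trans (λ n → cong₂ ℤ._+_ (P-unique bs S S′ 0 n) (V-unique bs S S′ 0 n))
  (solve 3 (λ q x y → q :* x :+ q :* y := q :* (x :+ y)) (λ _ → refl) (Hor₊ 2) (Path₊ 1) (Ver₊ 1)))
  where
  bs = ⊗-comm q (Hor₊ 2)
  S  = scale q (shift pathsAboveDiagonal)
  S′ = scale (Hor₊ 2) pathsAboveDiagonal

-- Elimination to a quadratic equation for `q`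

-- Identities are derived by writing the difference of their sides as a linear
-- combination of differences of known ones, which are then cancelled one at a time.
cancelling : ∀ f c {g h} → g ≈ h → f ⊕ c ⊗ (g ⊕ ⊖ h) ≈ f
cancelling f c {g} {h} g≈h =
  ≈-trans (+-congˡ {f} (*-congˡ {c} (+-congʳ {⊖ h} g≈h)))
          (solve 3 (λ f c h → f :+ c :* (h :- h) := f) (λ _ → refl) f c h)

-- Each coefficient equals the previous one and the first is 0. This serves as cancellation of the
-- factor 1 - t.
fixed-by-t : ∀ f → f ≈ t ⊗ f → f ≈ poly []
fixed-by-t f eq zero    = eq 0
fixed-by-t f eq (suc n) = trans (eq (suc n)) (trans (t⊗-suc f n) (fixed-by-t f eq n))

-- Written with ring operations, a polynomial becomes visible to the solver, with `t` as a variable;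
-- `:horner` is the matching syntax.
horner : List ℤ → Series
horner = foldr (λ c f → constant c ⊕ t ⊗ f) (constant 0ℤ)

poly≈horner : ∀ cs → poly cs ≈ horner cs
poly≈horner []       zero    = refl
poly≈horner []       (suc n) = refl
poly≈horner (c ∷ cs) zero    = sym (ℤ.+-identityʳ c)
poly≈horner (c ∷ cs) (suc n) = trans (poly≈horner cs n)
  (sym (trans (ℤ.+-identityˡ _) (t⊗-suc (horner cs) n)))

:horner : ∀ {m} → Polynomial m → List ℤ → Polynomial m
:horner t = foldr (λ c p → con c :+ t :* p) (con 0ℤ)

P₁ V₁ A₁ : Series
P₁ = Path₊ 1
V₁ = Ver₊ 1
A₁ = P₁ ⊕ V₁

-- Write V₀, D₀ for `Ver₊ 0`, `Dia₊ 0`. As V₀ + D₀ = q - 1, the equation for D₀ gives D₀ = t(2q -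
-- 1), and `t ⊗ A₁` is V₀ = q - 1 - D₀.
level-zero-relation : t ⊗ A₁ ≈ horner (- 1ℤ ∷ 1ℤ ∷ []) ⊕ horner (1ℤ ∷ - (+ 2) ∷ []) ⊗ q
level-zero-relation = ≈-trans
  (solve 5 (λ t q a v₀ d₀ →
      t :* a := :horner t (- 1ℤ ∷ 1ℤ ∷ []) :+ :horner t (1ℤ ∷ - (+ 2) ∷ []) :* q
                :+ :horner t (- 1ℤ ∷ 1ℤ ∷ []) :* (q :- (con 1ℤ :+ (v₀ :+ d₀)))
                :+ con (- 1ℤ) :* (v₀ :- t :* a)
                :+ con (- 1ℤ) :* (d₀ :- t :* (q :+ (v₀ :+ d₀))))
    (λ _ → refl) t q A₁ (Ver₊ 0) (Dia₊ 0))
  (≈-trans (cancelling _ (constant (- 1ℤ)) (Dia₊-step 0))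
  (≈-trans (cancelling _ (constant (- 1ℤ)) (Ver₊-step 0))
  (cancelling _ (horner (- 1ℤ ∷ 1ℤ ∷ [])) q-step)))

-- With D₁ for `Dia₊ 1`, V₁ + D₁ = P₁ - q gives D₁ = t(2P₁ - q); then P₁ is replaced by A₁ - V₁.
level-one-relation : A₁ ⊕ ⊖ q ⊕ t ⊗ (q ⊕ ⊖ (constant (+ 2) ⊗ A₁)) ≈ horner (+ 2 ∷ - (+ 2) ∷ []) ⊗ V₁
level-one-relation = ≈-trans
  (solve 5 (λ t q p v d →
      (p :+ v) :- q :+ t :* (q :- con (+ 2) :* (p :+ v)) :=
        :horner t (+ 2 ∷ - (+ 2) ∷ []) :* v
        :+ :horner t (1ℤ ∷ - 1ℤ ∷ []) :* (p :- (q :+ (v :+ d)))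
        :+ con 1ℤ :* (d :- t :* (p :+ (v :+ d))))
    (λ _ → refl) t q P₁ V₁ (Dia₊ 1))
  (≈-trans (cancelling _ (constant 1ℤ) (Dia₊-step 1))
  (cancelling _ (horner (1ℤ ∷ - 1ℤ ∷ []))
    (≈-trans (P-step pathsAboveDiagonal 0) (+-congʳ {V₁ ⊕ Dia₊ 1} (H-zero pathsAboveDiagonal)))))

-- `cross-ratio` removes level 2 from q V₁ = t q (P₂ + V₂), and `Hor₊ 2` is P₁ + q.
q⊗V₁ : q ⊗ V₁ ≈ t ⊗ (P₁ ⊕ q) ⊗ A₁
q⊗V₁ = ≈-trans
  (solve 7 (λ t q p a v a₂ h₂ →
      q :* v := t :* (p :+ q) :* a
                :+ q :* (v :- t :* a₂)
                :+ t :* (q :* a₂ :- h₂ :* a)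
                :+ t :* a :* (h₂ :- (p :+ q)))
    (λ _ → refl) t q P₁ A₁ V₁ (Path₊ 2 ⊕ Ver₊ 2) (Hor₊ 2))
  (≈-trans (cancelling _ (t ⊗ A₁) (+-congˡ {P₁} (H-zero pathsAboveDiagonal)))
  (≈-trans (cancelling _ t cross-ratio)
  (cancelling _ q (Ver₊-step 1))))

-- The difference of the two sides is annihilated by 1 - t, so it is a fixed point of t ⊗_.
quadratic : horner (1ℤ ∷ 1ℤ ∷ - (+ 3) ∷ []) ⊗ q ≈
            horner (1ℤ ∷ - 1ℤ ∷ []) ⊕ horner (0ℤ ∷ + 4 ∷ - (+ 6) ∷ []) ⊗ (q ⊗ q)
quadratic = ≈-trans
  (solve 2 (λ x y → x := y :+ (x :- y)) (λ _ → refl) lhs rhs)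
  (≈-trans (+-congˡ {rhs} (fixed-by-t (lhs ⊕ ⊖ rhs) fixed))
    (⊕-identityʳ rhs))
  where
  lhs = horner (1ℤ ∷ 1ℤ ∷ - (+ 3) ∷ []) ⊗ q
  rhs = horner (1ℤ ∷ - 1ℤ ∷ []) ⊕ horner (0ℤ ∷ + 4 ∷ - (+ 6) ∷ []) ⊗ (q ⊗ q)
  z = horner (- 1ℤ ∷ 1ℤ ∷ []) ⊕ horner (1ℤ ∷ - (+ 2) ∷ []) ⊗ q
  fixed : lhs ⊕ ⊖ rhs ≈ t ⊗ (lhs ⊕ ⊖ rhs)
  fixed = ≈-trans
    (solve 4 (λ t q p v →
        let a = p :+ v
            z = :horner t (- 1ℤ ∷ 1ℤ ∷ []) :+ :horner t (1ℤ ∷ - (+ 2) ∷ []) :* q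
            quad = :horner t (1ℤ ∷ 1ℤ ∷ - (+ 3) ∷ []) :* q
                   :- (:horner t (1ℤ ∷ - 1ℤ ∷ []) :+ :horner t (0ℤ ∷ + 4 ∷ - (+ 6) ∷ []) :* (q :* q))
        -- The factor 2t(1 - t) on the last relation lets the level-one relation remove V₁. What
        -- remains is F(ta) with F(X) = -X² + (1 - 5t + 3t²)qX - t(1 - t)q². Replacing ta by z costs
        -- the first product, and F(z) = (1 - t) quad.
        in quad := t :* quad
             :+ (z :+ t :* a :- :horner t (1ℤ ∷ - (+ 5) ∷ + 3 ∷ []) :* q) :* (t :* a :- z)
             :+ t :* (q :+ t :* a) :* ((a :- q :+ t :* (q :- con (+ 2) :* a))
                                       :- :horner t (+ 2 ∷ - (+ 2) ∷ []) :* v)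
             :+ :horner t (0ℤ ∷ + 2 ∷ - (+ 2) ∷ []) :* (q :* v :- t :* (p :+ q) :* a))
      (λ _ → refl) t q P₁ V₁)
    (≈-trans (cancelling _ (horner (0ℤ ∷ + 2 ∷ - (+ 2) ∷ [])) q⊗V₁)
    (≈-trans (cancelling _ (t ⊗ (q ⊕ t ⊗ A₁)) level-one-relation)
    (cancelling _ (z ⊕ t ⊗ A₁ ⊕ ⊖ (horner (1ℤ ∷ - (+ 5) ∷ + 3 ∷ []) ⊗ q)) level-zero-relation)))

-- The square root and the quotient

root : Series
root = denominator ⊗ q ⊕ ⊖ numeratorPoly

-- Completing the square: `quadratic` reads aq² - bq + c = 0 with a = 4t - 6t², b = 1 + t - 3t², c =
-- 1 - t. The denominator is -2a and the numerator polynomial -b, so `root` is b - 2aq, with square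
-- b² - 4ac and constant term 1.
isSqrt : IsSqrt root radicand
isSqrt = refl , ≈-trans (⊗-cong root≈ root≈)
  (≈-trans
    (solve 2 (λ t q →
        let num = :horner t (- 1ℤ ∷ - 1ℤ ∷ + 3 ∷ [])
            den = :horner t (0ℤ ∷ + 4 ∷ []) :* :horner t (- (+ 2) ∷ + 3 ∷ [])
        in (den :* q :- num) :* (den :* q :- num) :=
             :horner t (+ 1 ∷ - (+ 14) ∷ + 35 ∷ - (+ 30) ∷ + 9 ∷ [])
             :+ con (+ 2) :* den :*
                (:horner t (1ℤ ∷ 1ℤ ∷ - (+ 3) ∷ []) :* q
                 :- (:horner t (1ℤ ∷ - 1ℤ ∷ []) :+ :horner t (0ℤ ∷ + 4 ∷ - (+ 6) ∷ []) :* (q :* q))))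
      (λ _ → refl) t q)
  (≈-trans (cancelling _ (constant (+ 2) ⊗ (horner (0ℤ ∷ + 4 ∷ []) ⊗ horner (- (+ 2) ∷ + 3 ∷ []))) quadratic)
  (≈-sym (poly≈horner (+ 1 ∷ - (+ 14) ∷ + 35 ∷ - (+ 30) ∷ + 9 ∷ [])))))
  where
  root≈ : root ≈ horner (0ℤ ∷ + 4 ∷ []) ⊗ horner (- (+ 2) ∷ + 3 ∷ []) ⊗ q ⊕ ⊖ horner (- 1ℤ ∷ - 1ℤ ∷ + 3 ∷ [])
  root≈ = +-cong
    (*-congʳ {q} (⊗-cong (poly≈horner (0ℤ ∷ + 4 ∷ [])) (poly≈horner (- (+ 2) ∷ + 3 ∷ []))))
    (-‿cong (poly≈horner (- 1ℤ ∷ - 1ℤ ∷ + 3 ∷ [])))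

isQuotient : IsQuotient (generatingFunction (#Path 0)) (numeratorPoly ⊕ root) denominator
-- The coefficient of t in the denominator is -8.
isQuotient = (λ den≈0 → case den≈0 1 of λ ()) ,
  solve 2 (λ x y → x := y :+ (x :- y)) (λ _ → refl) (denominator ⊗ q) numeratorPoly

theorem4p1 : Σ[ p ∈ (ℕ → ℕ) ] CountsCatalanPaths M p ×
    (Σ[ root ∈ Series ] IsSqrt root radicand ×
    IsQuotient (generatingFunction p) (numeratorPoly ⊕ root) denominator)
theorem4p1 = #Path 0 , counts , root , isSqrt , isQuotient
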